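{- Let $G$ be a triangle-free graph of order $10$ with $\chi_1(G)=3$. Then either $G\cong G_5$, or there exists a vertex $u^*$ of $G$ such that $G-u^*\cong G_i$ for some $i$ with $1\le i\le 4$.
   Context: Graphs are finite, undirected, with no loops or multiple edges. The order of a graph is its number of vertices. $\Delta(G)$ is the maximum degree, $G[U]$ is the subgraph induced on $U$, and $G-u^*$ is the graph obtained by deleting the vertex $u^*$. For a nonnegative integer $k$, a set $U\subseteq V(G)$ is $k$-independent if $\Delta(G[U])\le k$. $G$ is $(m,k)$-colourable if $V(G)$ can be partitioned into $m$ (possibly empty) $k$-independent sets. The $k$-defective chromatic number $\chi_k(G)$ is the least positive integer $m$ for which $G$ is $(m,k)$-colourable. The graphs $G_1,\dots,G_5$ are defined as follows ("$X$ is completely joined to $Y$" means every vertex of $X$ is adjacent to every vertex of $Y$; there are no edges other than those listed). $G_1,G_2,G_3$ have the 9 vertices $u,u_1,u_2,u_3,u_4,z_1,z_2,z,z_3$. In each, $u$ is adjacent to $u_1,u_2,u_3,u_4$; $\{u_1,u_2\}$ is completely joined to $\{z_1,z_2\}$; and $\{u_3,u_4\}$ is completely joined to $\{z,z_3\}$. In addition: $G_1$ has the edges $zz_1, zz_2$; $G_2$ has the edges $zz_1,zz_2,z_3z_1$; $G_3$ has the edges $zz_1,zz_2,z_3z_1,z_3z_2$. $G_4$ has the 9 vertices $u,u_1,u_2,u_3,u_4,u_5,z_1,z_2,z$; $u$ is adjacent to $u_1,\dots,u_5$; $\{u_1,u_2\}$ is completely joined to $\{z_1,z_2\}$; $z$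 is adjacent to $u_3,u_4,u_5,z_1,z_2$. $G_5$ has the 10 vertices $u,v,u_1,u_2,u_3,u_4,u_5,z_1,z_2,z$; $\{u,v\}$ is completely joined to $\{u_1,u_2,u_3,u_4,u_5\}$; $z$ is adjacent to $u_1,u_2,z_1,z_2$; $z_1$ is adjacent to $u_3,u_4$; $z_2$ is adjacent to $u_3,u_5$. -}

module Defs where

open import Data.Fin using (#_)
open import Data.Fin.Base using (Fin; punchIn)
open import Data.Fin.Permutation using (Permutation; _⟨$⟩ʳ_)
open import Data.Fin.Properties using (_≟_)
open import Data.Fin.Subset using (Subset; _∈_)
open import Data.Fin.Subset.Properties using (_∈?_)
open import Data.List.Base
  using (List; []; _∷_; _++_; allFin; cartesianProduct; filter; length; lookup; map)
open import Data.List.Extrema.Nat using (max)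
import Data.List.Membership.DecPropositional as DecMembership
open import Data.Nat.Base using (ℕ; _≤_)
open import Data.Product using (_×_; _,_; ∃!; Σ-syntax)
open import Data.Product.Properties using (≡-dec)
open import Data.Sum.Base using (_⊎_; swap)
open import Function.Base using (_∘_)
open import Function.Bundles using (_⇔_)
open import Level using (0ℓ)
open import Relation.Binary.Core using (Rel)
open import Relation.Binary.Definitions using (Decidable; Symmetric)
open import Relation.Binary.PropositionalEquality using (_≡_; _≢_; refl; ≢-sym)
open import Relation.Nullary using (¬_; ¬?; _×-dec_; _⊎-dec_)

-- `Graph n` is the type of simple graphs of order n, with vertex set Fin n.
-- Decidability of adjacency is automatic classically.
record Graph (n : ℕ) : Set₁ where
  field
    Adj       : Rel (Fin n) 0ℓ
    adj?      : Decidable Adj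
    symmetric : Symmetric Adj
    loopless  : ∀ v → ¬ Adj v v

open Graph public

pullback : ∀ {m n} → (Fin m → Fin n) → Graph n → Graph m
pullback f G = record
  { Adj       = λ v w → Adj G (f v) (f w)
  ; adj?      = λ v w → adj? G (f v) (f w)
  ; symmetric = symmetric G
  ; loopless  = loopless G ∘ f
  }

elements : ∀ {n} → Subset n → List (Fin n)
elements {n} U = filter (_∈? U) (allFin n)

-- G[U]: its i-th vertex is the i-th element of U in increasing order.
induced : ∀ {n} (G : Graph n) (U : Subset n) → Graph (length (elements U))
induced G U = pullback (lookup (elements U)) G

-- G − u: `punchIn u` enumerates the vertices other than u.
infixl 6 _-_
_-_ : ∀ {n} → Graph (ℕ.suc n) → Fin (ℕ.suc n) → Graph n
G - u = pullback (punchIn u) G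

degree : ∀ {n} → Graph n → Fin n → ℕ
degree {n} G v = length (filter (adj? G v) (allFin n))

-- The graph of order 0 has maximum degree 0, so the empty set is
-- k-independent for every k.
Δ : ∀ {n} → Graph n → ℕ
Δ {n} G = max 0 (map (degree G) (allFin n))

TriangleFree : ∀ {n} → Graph n → Set
TriangleFree G = ∀ a b c → ¬ (Adj G a b × Adj G b c × Adj G c a)

Independent : ∀ {n} → ℕ → Graph n → Subset n → Set
Independent k G U = Δ (induced G U) ≤ k

-- V(G) is partitioned by U when each vertex lies in exactly one class U i;
-- classes may be empty.
Colourable : ∀ {n} → ℕ → ℕ → Graph n → Set
Colourable {n} m k G =
  Σ[ U ∈ (Fin m → Subset n) ]
    (∀ v → ∃! _≡_ (λ i → v ∈ U i)) × (∀ i → Independent k G (U i))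

-- `IsDefectiveChromaticNumber k G m` says χ_k(G) = m.
record IsDefectiveChromaticNumber {n} (k : ℕ) (G : Graph n) (m : ℕ) : Set where
  field
    positive   : 1 ≤ m
    colourable : Colourable m k G
    least      : ∀ m′ → 1 ≤ m′ → Colourable m′ k G → m ≤ m′

infix 4 _≅_
record _≅_ {m n} (G : Graph m) (H : Graph n) : Set where
  field
    bijection : Permutation m n
    adjacency : ∀ v w → Adj G v w ⇔ Adj H (bijection ⟨$⟩ʳ v) (bijection ⟨$⟩ʳ w)

-- Each edge need be listed in one orientation only.
fromEdges : ∀ {n} → List (Fin n × Fin n) → Graph n
fromEdges {n} es = record
  { Adj       = λ v w → v ≢ w × ((v , w) ∈ₑ es ⊎ (w , v) ∈ₑ es)
  ; adj?      = λ v w → ¬? (v ≟ w) ×-dec (((v , w) ∈ₑ? es) ⊎-dec ((w , v) ∈ₑ? es))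
  ; symmetric = λ (v≢w , e) → ≢-sym v≢w , swap e
  ; loopless  = λ v (v≢v , _) → v≢v refl
  }
  where
  open DecMembership (≡-dec (_≟_ {n}) _≟_) renaming (_∈_ to _∈ₑ_; _∈?_ to _∈ₑ?_)

infix 6 _⋈_
_⋈_ : ∀ {n} → List (Fin n) → List (Fin n) → List (Fin n × Fin n)
_⋈_ = cartesianProduct

module G₁₋₃ where
  u u₁ u₂ u₃ u₄ z₁ z₂ z z₃ : Fin 9
  u  = # 0
  u₁ = # 1
  u₂ = # 2
  u₃ = # 3
  u₄ = # 4
  z₁ = # 5
  z₂ = # 6
  z  = # 7
  z₃ = # 8

  common : List (Fin 9 × Fin 9)
  common = (u ∷ []) ⋈ (u₁ ∷ u₂ ∷ u₃ ∷ u₄ ∷ [])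
        ++ (u₁ ∷ u₂ ∷ []) ⋈ (z₁ ∷ z₂ ∷ [])
        ++ (u₃ ∷ u₄ ∷ []) ⋈ (z ∷ z₃ ∷ [])

G₁ : Graph 9
G₁ = fromEdges (common ++ (z , z₁) ∷ (z , z₂) ∷ [])
  where open G₁₋₃

G₂ : Graph 9
G₂ = fromEdges (common ++ (z , z₁) ∷ (z , z₂) ∷ (z₃ , z₁) ∷ [])
  where open G₁₋₃

G₃ : Graph 9
G₃ = fromEdges (common ++ (z , z₁) ∷ (z , z₂) ∷ (z₃ , z₁) ∷ (z₃ , z₂) ∷ [])
  where open G₁₋₃

G₄ : Graph 9
G₄ = fromEdges ((u ∷ []) ⋈ (u₁ ∷ u₂ ∷ u₃ ∷ u₄ ∷ u₅ ∷ [])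
             ++ (u₁ ∷ u₂ ∷ []) ⋈ (z₁ ∷ z₂ ∷ [])
             ++ (z ∷ []) ⋈ (u₃ ∷ u₄ ∷ u₅ ∷ z₁ ∷ z₂ ∷ []))
  where
  u u₁ u₂ u₃ u₄ u₅ z₁ z₂ z : Fin 9
  u  = # 0
  u₁ = # 1
  u₂ = # 2
  u₃ = # 3
  u₄ = # 4
  u₅ = # 5
  z₁ = # 6
  z₂ = # 7
  z  = # 8

G₅ : Graph 10
G₅ = fromEdges ((u ∷ v ∷ []) ⋈ (u₁ ∷ u₂ ∷ u₃ ∷ u₄ ∷ u₅ ∷ [])
             ++ (z ∷ []) ⋈ (u₁ ∷ u₂ ∷ z₁ ∷ z₂ ∷ [])
             ++ (z₁ ∷ []) ⋈ (u₃ ∷ u₄ ∷ [])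
             ++ (z₂ ∷ []) ⋈ (u₃ ∷ u₅ ∷ []))
  where
  u v u₁ u₂ u₃ u₄ u₅ z₁ z₂ z : Fin 10
  u  = # 0
  v  = # 1
  u₁ = # 2
  u₂ = # 3
  u₃ = # 4
  u₄ = # 5
  u₅ = # 6
  z₁ = # 7
  z₂ = # 8
  z  = # 9

{-# OPTIONS --safe #-}

-- Let u be a vertex of maximum degree d, N its neighbourhood and R the remaining vertices.  If d ≤ 3, a
-- bipartition with the fewest monochromatic edges is a (2,1)-colouring (Lovász).  If d ≥ 4, then |R| ≤ 5.  As N is
-- independent, G is determined by G[R] and the multiset of the traces on R of the neighbourhoods of the vertices
-- of N, and these traces are independent sets of size less than d.  This leaves about 40000 adjacency matrices,
-- which are settled by evaluation: each has a (2,1)-colouring, or a vertex of degree exceeding d, or becomes one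
-- of the listed graphs (after deletion of its first vertex, for G₁, …, G₄) under a suitable reordering.
-- All but at most one of the vertices of N lie on the same side of a (2,1)-colouring, namely opposite to u, so
-- only the part of R on that side, and the exceptional vertex of N, have to be searched for.

module Submission where

open import Data.Product.Base using (∃-syntax)
open import Data.Sum.Base using (_⊎_)
open import Defs
open import Data.Bool.Base using (Bool; true; false; T; not; _∧_; _∨_; if_then_else_)
open import Data.Bool.ListAction using (all; and; any)
import Data.Bool.Properties as Bool
open import Data.Empty using (⊥)
open import Data.Fin.Base using (Fin; zero; suc; punchIn; punchOut)
open import Data.Fin.Patterns using (0F; 1F)
open import Data.Fin.Permutation using (permutation)
open import Data.Fin.Properties using (_≟_; punchIn-injective; punchInᵢ≢i; punchIn-punchOut)
import Data.Fin.Subset as Subset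
open import Data.List.Base
  using (List; []; _∷_; _++_; allFin; concatMap; drop; filter; filterᵇ; length; lookup; map; replicate; tabulate;
         upTo; zipWith)
import Data.List.Extrema.Nat as Extrema
open import Data.List.Membership.DecPropositional using (_∈?_)
open import Data.List.Membership.Propositional using (_∈_; find; lose)
open import Data.List.Membership.Propositional.Properties
  using (∈-++⁺ˡ; ∈-++⁺ʳ; ∈-++⁻; ∈-allFin; ∈-concatMap⁺; ∈-filter⁺; ∈-filter⁻; ∈-lookup; ∈-map⁺; ∈-upTo⁺; ∈-∃++)
open import Data.List.Properties
  using (length-++; length-map; length-tabulate; map-++; map-cong; map-cong-local; map-tabulate; map-∘;
         tabulate-cong; tabulate-lookup; ≡-dec)
open import Data.List.Relation.Binary.Permutation.Propositional as ↭
  using (_↭_; refl; prep; swap; ↭-sym; ↭-trans; ↭⇒↭ₛ)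
open import Data.List.Relation.Binary.Permutation.Propositional.Properties
  using (++-assoc; ++-comm; ++-identityʳ; ++⁺; ++⁺ʳ; ++⁺ˡ; All-resp-↭; map⁺; shift; shifts; ↭-length; ∈-resp-↭)
import Data.List.Relation.Binary.Permutation.Setoid.Properties as ↭ₛ
open import Data.List.Relation.Binary.Pointwise using (≡⇒Pointwise-≡; tabulate⁻)
open import Data.List.Relation.Unary.All as All using (All; []; _∷_)
import Data.List.Relation.Unary.All.Properties as All
open import Data.List.Relation.Unary.AllPairs using ([]; _∷_)
open import Data.List.Relation.Unary.Any as Any using (Any; here; there)
import Data.List.Relation.Unary.Any.Properties as Any
open import Data.List.Relation.Unary.Unique.Propositional using (Unique)
import Data.List.Relation.Unary.Unique.Propositional.Properties as Unique
open import Data.Maybe.Base as Maybe using (Maybe; just; nothing)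
open import Data.Nat.Base
  using (ℕ; zero; suc; 2+; _+_; _∸_; _≤_; _<_; _≡ᵇ_; _≤ᵇ_; _<ᵇ_; z≤n; s≤s; s≤s⁻¹)
open import Data.Nat.Induction using (<-wellFounded)
open import Data.Nat.Properties hiding (_≟_)
open import Data.Product.Base using (_×_; _,_; ∃; ∃₂; map₂; proj₁; proj₂)
open import Data.Sum.Base using (inj₁; inj₂; [_,_]′)
import Data.Vec.Base as Vec
import Data.Vec.Properties as Vec
open import Function.Base using (_∘_; id)
open import Function.Bundles using (module Equivalence; mk⇔)
open import Induction.WellFounded using (Acc; acc)
open import Relation.Binary.PropositionalEquality hiding ([_])
open import Relation.Nullary using (Dec; yes; no; contradiction; does; ¬_)
open import Relation.Nullary.Decidable using (dec-false; dec-true; does-⇔; toSum)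
open import Relation.Unary using (Decidable)

private
  variable
    A : Set

-- Adjacency matrices by rows, relative to an ordering of the vertices.

Matrix : Set
Matrix = List (List Bool)

weight : List Bool → ℕ
weight []           = 0
weight (true  ∷ bs) = suc (weight bs)
weight (false ∷ bs) = weight bs

common : List Bool → List Bool → ℕ
common (true  ∷ bs) (true  ∷ cs) = suc (common bs cs)
common (true  ∷ bs) (false ∷ cs) = common bs cs
common (false ∷ bs) (_     ∷ cs) = common bs cs
common _            _            = 0

-- Enumeration of triangle-free graphs by a vertex of maximum degree

bitLists : ℕ → List (List Bool)
bitLists zero    = [] ∷ []
bitLists (suc n) = map (false ∷_) (bitLists n) ++ map (true ∷_) (bitLists n)

-- The entries follow the order of `ts`: one list per multiset is enough because the vertices of N
-- may be reordered freely.
multisets : ℕ → List A → List (List A)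
multisets zero    ts       = [] ∷ []
multisets (suc k) []       = []
multisets (suc k) (t ∷ ts) = map (t ∷_) (multisets k (t ∷ ts)) ++ multisets (suc k) ts

independent? : List Bool → Matrix → Bool
independent? S R = and (zipWith (λ s row → not s ∨ (common S row ≡ᵇ 0)) S R)

-- The inequality is strict because a neighbour of u is adjacent to u as well as to its trace.
types : ℕ → Matrix → List (List Bool)
types d R = filterᵇ (λ S → independent? S R ∧ (weight S <ᵇ d)) (bitLists (length R))

headOr : A → List A → A
headOr a []      = a
headOr a (x ∷ _) = x

-- The number of columns is an argument because it cannot be read off when `ts` is empty. The
-- default `false` enters only if some row is shorter than that.
columns : ℕ → Matrix → Matrix
columns zero    ts = []
columns (suc r) ts = map (headOr false) ts ∷ columns r (map (drop 1) ts)

-- The vertices are ordered as u, N, R; the matrix R is that of the graph induced on R, and ts lists the traces on R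
-- of the vertices of N.
extend : Matrix → List (List Bool) → Matrix
extend R ts =
  (false ∷ replicate (length ts) true ++ replicate (length R) false) ∷
  map (λ t → true ∷ replicate (length ts) false ++ t) ts ++
  zipWith (λ col row → false ∷ col ++ row) (columns (length R) ts) R

bounded : ℕ → Matrix → Bool
bounded d M = all (λ row → weight row ≤ᵇ d) M

extensions : ℕ → Matrix → List Matrix
extensions d R = filterᵇ (bounded d) (map (extend R) (multisets d (types d R)))

-- Every triangle-free graph of order n has an ordering whose matrix is listed, provided that fuel ≥ n.
normalForms : ℕ → ℕ → List Matrix
normalForms fuel       zero    = [] ∷ []
normalForms zero       (suc n) = []
normalForms (suc fuel) (suc n) =
  concatMap (λ d → concatMap (extensions d) (normalForms fuel (n ∸ d))) (upTo (suc n))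

-- A vertex of R is `out` if it lies on the side of u.  Otherwise it lies opposite to u, and it is `full` or `free`
-- according to whether it already has a neighbour on its side.
data Slot : Set where
  out full free : Slot

-- A vertex of N on the side of u already has u as a neighbour there, so it tolerates no neighbour
-- among the `out` vertices.
covers : List Slot → List Bool → Bool
covers (out ∷ s) (true ∷ t) = false
covers (_   ∷ s) (_    ∷ t) = covers s t
covers _         _          = true

avoids : List Slot → List Bool → Bool
avoids (full ∷ s) (true ∷ t) = false
avoids (free ∷ s) (true ∷ t) = false
avoids (_    ∷ s) (_    ∷ t) = avoids s t
avoids _          _          = true

-- A vertex of N placed opposite to u may have one neighbour of R on its side, which must be `free`
-- and thereby becomes `full`. Its `out` neighbours impose no condition; `nothing` means that it
-- does not fit.
fill : List Slot → List Bool → Maybe (List Slot)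
fill (x    ∷ s) (false ∷ t) = Maybe.map (x ∷_) (fill s t)
fill (out  ∷ s) (true  ∷ t) = Maybe.map (out ∷_) (fill s t)
fill (full ∷ s) (true  ∷ t) = nothing
fill (free ∷ s) (true  ∷ t) = if avoids s t then just (full ∷ s) else nothing
fill s          t           = just s

-- The Boolean argument tells whether one vertex of N may still be placed on the side of u.
search  : Bool → List Slot → List (List Bool) → Bool
search′ : Bool → Maybe (List Slot) → List (List Bool) → Bool

search y s []       = true
search y s (t ∷ ts) = search′ y (fill s t) ts ∨ (y ∧ (covers s t ∧ search false s ts))

search′ y (just s) ts = search y s ts
search′ y nothing  ts = false

-- The two numbers are the degrees of the vertex into X and into its complement in R; only the one
-- for its own side counts, and a value of two or more rules X out.
slot : Bool → ℕ → ℕ → Maybe Slot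
slot true  0       _       = just free
slot true  1       _       = just full
slot true  (2+ _)  _       = nothing
slot false _       0       = just out
slot false _       1       = just out
slot false _       (2+ _)  = nothing

-- X is the set of vertices of R opposite to u; the other arguments are final segments of X and of the rows of R.
slots : List Bool → List Bool → Matrix → Maybe (List Slot)
slots X (x ∷ xs) (row ∷ R) =
  Maybe.zipWith _∷_ (slot x (common row X) (common row (map not X))) (slots X xs R)
slots X []       []        = just []
slots X _        _         = nothing

partitions : Matrix → List (Maybe (List Slot))
partitions R = map (λ X → slots X X R) (bitLists (length R))

colourable : List (Maybe (List Slot)) → List (List Bool) → Bool
colourable ss ts = any (λ s → search′ true s ts) ss

-- An index past the end picks the last entry, so `permute` rearranges its list whatever the code,
-- and codes need no validity condition.
pick : ℕ → A → List A → A × List A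
pick zero    x xs       = x , xs
pick (suc k) x []       = x , []
pick (suc k) x (y ∷ ys) = map₂ (x ∷_) (pick k y ys)

-- The first argument is a Lehmer code, possibly without its trailing zeros.
permute : List ℕ → List A → List A
permute []      xs       = xs
permute (k ∷ c) []       = []
permute (k ∷ c) (x ∷ xs) = let (y , ys) = pick k x xs in y ∷ permute c ys

matrix : ∀ {n} → Graph n → Matrix
matrix {n} G = map (λ v → map (λ w → does (adj? G v w)) (allFin n)) (allFin n)

_≟ᴹ_ : (M N : Matrix) → Dec (M ≡ N)
_≟ᴹ_ = ≡-dec (≡-dec Bool._≟_)

minor : Matrix → Matrix
minor M = map (drop 1) (drop 1 M)

conjugate : List ℕ → Matrix → Matrix
conjugate c M = permute c (map (permute c) M)

exceptional : Matrix → List Matrix → Matrix → Bool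
exceptional g gs M = does (M ≟ᴹ g) ∨ any (λ g′ → does (minor M ≟ᴹ g′)) gs

settled : ℕ → List (List ℕ) → Matrix → List Matrix → List (Maybe (List Slot)) → List (List Bool) → Matrix →
          Bool
settled d cs g gs ss ts M =
  colourable ss ts ∨ not (bounded d M) ∨ any (λ c → exceptional g gs (conjugate c M)) cs

settledNormalForm : ℕ → List (List ℕ) → Matrix → List Matrix → Matrix → Bool
settledNormalForm d cs g gs R = bounded 1 R ∨ rest (partitions R)
  -- The slots depend on R alone, so they serve for all choices of traces.
  where
  rest : List (Maybe (List Slot)) → Bool
  rest ss = all (λ ts → settled d cs g gs ss ts (extend R ts)) (multisets d (types d R))

-- Here n + 1 is the order of the graph and d its maximum degree, so that |R| = n ∸ d.
verify : ℕ → List (List ℕ) → Matrix → List Matrix → ℕ → Bool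
verify n cs g gs d = all (settledNormalForm d cs g gs) (normalForms (n ∸ 4) (n ∸ d))

-- Reordering lists

select : List Bool → List A → List A
select X           []       = []
select []          (x ∷ xs) = []
select (true  ∷ X) (x ∷ xs) = x ∷ select X xs
select (false ∷ X) (x ∷ xs) = select X xs

weight-++ : ∀ bs cs → weight (bs ++ cs) ≡ weight bs + weight cs
weight-++ []           cs = refl
weight-++ (true  ∷ bs) cs = cong suc (weight-++ bs cs)
weight-++ (false ∷ bs) cs = weight-++ bs cs

weight-∷ : ∀ b cs → weight (b ∷ cs) ≡ weight (b ∷ []) + weight cs
weight-∷ b = weight-++ (b ∷ [])

weight-↭ : ∀ {bs cs} → bs ↭ cs → weight bs ≡ weight cs
weight-↭ refl                   = refl
weight-↭ (prep true  p)         = cong suc (weight-↭ p)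
weight-↭ (prep false p)         = weight-↭ p
weight-↭ (swap true  true  p)   = cong (2 +_) (weight-↭ p)
weight-↭ (swap true  false p)   = cong suc (weight-↭ p)
weight-↭ (swap false true  p)   = cong suc (weight-↭ p)
weight-↭ (swap false false p)   = weight-↭ p
weight-↭ (↭.trans p q)          = trans (weight-↭ p) (weight-↭ q)

weight-replicate-true : ∀ n → weight (replicate n true) ≡ n
weight-replicate-true zero    = refl
weight-replicate-true (suc n) = cong suc (weight-replicate-true n)

weight-replicate-false : ∀ n → weight (replicate n false) ≡ 0
weight-replicate-false zero    = refl
weight-replicate-false (suc n) = weight-replicate-false n

∈⇒↭∷ : ∀ {x : A} {xs} → x ∈ xs → ∃ λ ys → xs ↭ x ∷ ys
∈⇒↭∷ x∈xs with ys , zs , refl ← ∈-∃++ x∈xs = ys ++ zs , shift _ ys zs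

divide : ∀ (p : A → Bool) xs → ∃₂ λ ys zs →
         ys ++ zs ↭ xs × All (λ x → p x ≡ true) ys × All (λ x → p x ≡ false) zs
divide p [] = [] , [] , refl , [] , []
divide p (x ∷ xs) with divide p xs | p x in eq
... | ys , zs , q , ps , qs | true  = x ∷ ys , zs , prep x q , eq ∷ ps , qs
... | ys , zs , q , ps , qs | false = ys , x ∷ zs , ↭-trans (shift x ys zs) (prep x q) , ps , eq ∷ qs

map≡replicate : ∀ {B : Set} {f : A → B} {b xs} → All (λ x → f x ≡ b) xs →
                map f xs ≡ replicate (length xs) b
map≡replicate []       = refl
map≡replicate (p ∷ ps) = cong₂ _∷_ p (map≡replicate ps)

zipWith-diagonal : ∀ {B C D : Set} (h : B → C → D) (f : A → B) (g : A → C) xs →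
                   zipWith h (map f xs) (map g xs) ≡ map (λ x → h (f x) (g x)) xs
zipWith-diagonal h f g []       = refl
zipWith-diagonal h f g (x ∷ xs) = cong (_ ∷_) (zipWith-diagonal h f g xs)

multisets-complete : ∀ {V : Set} (f : V → List Bool) k ts vs → length vs ≡ k →
                     All (λ v → f v ∈ ts) vs →
                     ∃ λ vs′ → vs′ ↭ vs × map f vs′ ∈ multisets k ts
multisets-complete f zero    ts       []       eq ps = [] , refl , here refl
multisets-complete f (suc k) []       (v ∷ vs) eq (() ∷ _)
multisets-complete f (suc k) (t ∷ ts) vs       eq ps =
  [ (λ q →
      let v , v∈vs , fv≡t = find q
          ws , vs↭v∷ws = ∈⇒↭∷ v∈vs
          ws′ , ws′↭ws , mem = multisets-complete f k (t ∷ ts) ws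
            (suc-injective (trans (sym (↭-length vs↭v∷ws)) eq))
            (All.tail (All-resp-↭ vs↭v∷ws ps))
      in v ∷ ws′ , ↭-trans (prep v ws′↭ws) (↭-sym vs↭v∷ws) ,
         ∈-++⁺ˡ (subst (λ u → u ∷ map f ws′ ∈ map (t ∷_) (multisets k (t ∷ ts))) (sym fv≡t)
                       (∈-map⁺ (t ∷_) mem)))
  , (λ ¬q →
      let vs′ , vs′↭vs , mem = multisets-complete f (suc k) ts vs eq (All.zipWith
            (λ (m , fv≢t) → Any.tail fv≢t m) (ps , All.¬Any⇒All¬ vs ¬q))
      in vs′ , vs′↭vs , ∈-++⁺ʳ _ mem)
  ]′ (toSum (Any.any? (λ v → ≡-dec Bool._≟_ (f v) t) vs))

bitLists-complete : ∀ bs → bs ∈ bitLists (length bs)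
bitLists-complete []           = here refl
bitLists-complete (false ∷ bs) = ∈-++⁺ˡ (∈-map⁺ (false ∷_) (bitLists-complete bs))
bitLists-complete (true  ∷ bs) = ∈-++⁺ʳ _ (∈-map⁺ (true ∷_) (bitLists-complete bs))

pick-↭ : ∀ k (x : A) xs → let (y , ys) = pick k x xs in y ∷ ys ↭ x ∷ xs
pick-↭ zero    x xs       = refl
pick-↭ (suc k) x []       = refl
pick-↭ (suc k) x (y ∷ ys) = ↭-trans (swap _ x refl) (prep x (pick-↭ k y ys))

permute-↭ : ∀ c (xs : List A) → permute c xs ↭ xs
permute-↭ []      xs       = refl
permute-↭ (k ∷ c) []       = refl
permute-↭ (k ∷ c) (x ∷ xs) = ↭-trans (prep _ (permute-↭ c _)) (pick-↭ k x xs)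

pick-map : ∀ {B : Set} (f : A → B) k x xs →
           let (y , ys) = pick k x xs in pick k (f x) (map f xs) ≡ (f y , map f ys)
pick-map f zero    x xs       = refl
pick-map f (suc k) x []       = refl
pick-map f (suc k) x (y ∷ ys) rewrite pick-map f k y ys = refl

permute-map : ∀ {B : Set} (f : A → B) c xs → permute c (map f xs) ≡ map f (permute c xs)
permute-map f []      xs       = refl
permute-map f (k ∷ c) []       = refl
permute-map f (k ∷ c) (x ∷ xs) rewrite pick-map f k x xs = cong (_ ∷_) (permute-map f c _)

-- Orderings of a graph given by a Boolean adjacency function

module Neighbours {V : Set} (adj : V → V → Bool)
  (adj-sym : ∀ v w → adj v w ≡ adj w v) (adj-irrefl : ∀ v → adj v v ≡ false) where

  row : List V → V → List Bool
  row L v = map (adj v) L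

  rows : List V → Matrix
  rows L = map (row L) L

  deg : V → List V → ℕ
  deg v L = weight (row L v)

  deg-++ : ∀ v K L → deg v (K ++ L) ≡ deg v K + deg v L
  deg-++ v K L = trans (cong weight (map-++ (adj v) K L)) (weight-++ (row K v) _)

  deg-↭ : ∀ v {K L} → K ↭ L → deg v K ≡ deg v L
  deg-↭ v p = weight-↭ (map⁺ (adj v) p)

  deg-self : ∀ v L → deg v (v ∷ L) ≡ deg v L
  deg-self v L = cong (λ b → weight (b ∷ row L v)) (adj-irrefl v)

  deg-adjacent : ∀ {v w} L → adj v w ≡ true → deg v (w ∷ L) ≡ suc (deg v L)
  deg-adjacent {v} L eq = cong (λ b → weight (b ∷ row L v)) eq

  deg-nonadjacent : ∀ {v w} L → adj v w ≡ false → deg v (w ∷ L) ≡ deg v L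
  deg-nonadjacent {v} L eq = cong (λ b → weight (b ∷ row L v)) eq

  deg-all : ∀ {v L} → All (λ w → adj v w ≡ true) L → deg v L ≡ length L
  deg-all {L = L} ps = trans (cong weight (map≡replicate ps)) (weight-replicate-true (length L))

  deg-none : ∀ {v L} → All (λ w → adj v w ≡ false) L → deg v L ≡ 0
  deg-none {L = L} ps = trans (cong weight (map≡replicate ps)) (weight-replicate-false (length L))

  -- Bipartitions with sparse sides, and the case of maximum degree at most 3

  Sparse : List V → Set
  Sparse L = All (λ v → deg v L ≤ 1) L

  Bipartition : List V → Set
  Bipartition vs = ∃₂ λ K L → K ++ L ↭ vs × Sparse K × Sparse L

  -- Every edge is counted once, at whichever of its ends comes first in the list.
  edges : List V → ℕ
  edges []      = 0
  edges (v ∷ L) = deg v L + edges L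

  edges-↭ : ∀ {K L} → K ↭ L → edges K ≡ edges L
  edges-↭ refl                  = refl
  edges-↭ (prep v p)            = cong₂ _+_ (deg-↭ v p) (edges-↭ p)
  -- An edge between the two vertices is counted at `v` before the swap and at `w` after it;
  -- symmetry of `adj` makes the contributions equal.
  edges-↭ (swap {K} {L} v w p)  = begin
    deg v (w ∷ K) + (deg w K + edges K)
      ≡⟨ cong (_+ (deg w K + edges K)) (weight-∷ (adj v w) (row K v)) ⟩
    weight (adj v w ∷ []) + deg v K + (deg w K + edges K)
      ≡⟨ cong (λ b → weight (b ∷ []) + deg v K + (deg w K + edges K)) (adj-sym v w) ⟩
    weight (adj w v ∷ []) + deg v K + (deg w K + edges K)
      ≡⟨ +-assoc (weight (adj w v ∷ [])) (deg v K) _ ⟩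
    weight (adj w v ∷ []) + (deg v K + (deg w K + edges K))
      ≡⟨ cong (weight (adj w v ∷ []) +_) (+-assoc (deg v K) (deg w K) _) ⟨
    weight (adj w v ∷ []) + (deg v K + deg w K + edges K)
      ≡⟨ cong (λ n → weight (adj w v ∷ []) + (n + edges K)) (+-comm (deg v K) (deg w K)) ⟩
    weight (adj w v ∷ []) + (deg w K + deg v K + edges K)
      ≡⟨ cong (weight (adj w v ∷ []) +_) (+-assoc (deg w K) (deg v K) _) ⟩
    weight (adj w v ∷ []) + (deg w K + (deg v K + edges K))
      ≡⟨ +-assoc (weight (adj w v ∷ [])) (deg w K) _ ⟨
    weight (adj w v ∷ []) + deg w K + (deg v K + edges K)
      ≡⟨ cong (_+ (deg v K + edges K)) (weight-∷ (adj w v) (row K w)) ⟨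
    deg w (v ∷ K) + (deg v K + edges K)
      ≡⟨ cong₂ _+_ (deg-↭ w (prep v p)) (cong₂ _+_ (deg-↭ v p) (edges-↭ p)) ⟩
    deg w (v ∷ L) + (deg v L + edges L) ∎
    where open ≡-Reasoning
  edges-↭ (↭.trans p q)         = trans (edges-↭ p) (edges-↭ q)

  -- Of the at most three neighbours of `v`, at least two lie in `K`, hence at most one in `L`. The
  -- move therefore removes at least two monochromatic edges and creates at most one.
  move : ∀ {v} K L → v ∈ K → 2 ≤ deg v K → deg v (K ++ L) ≤ 3 →
         ∃ λ K′ → K′ ++ v ∷ L ↭ K ++ L × edges K′ + edges (v ∷ L) < edges K + edges L
  move {v} K L v∈K 2≤ ≤3 with K′ , p ← ∈⇒↭∷ v∈K =
    K′ , ↭-trans (shift v K′ L) (++⁺ʳ L (↭-sym p)) , (begin-strict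
      edges K′ + (deg v L + edges L)  ≡⟨ +-assoc (edges K′) (deg v L) _ ⟨
      edges K′ + deg v L + edges L    ≡⟨ cong (_+ edges L) (+-comm (edges K′) (deg v L)) ⟩
      deg v L + edges K′ + edges L    <⟨ +-monoˡ-< (edges L) (+-monoˡ-< (edges K′) fewer) ⟩
      deg v K + edges K′ + edges L    ≡⟨ cong (λ n → n + edges K′ + edges L)
                                            (trans (deg-↭ v p) (deg-self v K′)) ⟩
      edges (v ∷ K′) + edges L        ≡⟨ cong (_+ edges L) (edges-↭ p) ⟨
      edges K + edges L               ∎)
    where
    open ≤-Reasoning
    fewer : deg v L < deg v K
    fewer = ≤-trans (s≤s (+-cancelˡ-≤ 2 _ 1 (≤-trans (+-monoˡ-≤ (deg v L) 2≤)
              (subst (_≤ 3) (deg-++ v K L) ≤3)))) 2≤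

  -- All vertices start on one side, and crowded ones are moved across. The number of monochromatic
  -- edges drops each time, so the process ends, and it can end only when both sides are sparse.
  bipartition-cubic : ∀ {vs} → All (λ v → deg v vs ≤ 3) vs → Bipartition vs
  bipartition-cubic {vs} cubic = improve vs [] (++-identityʳ vs) (<-wellFounded _)
    where
    Crowded? : ∀ L → Sparse L ⊎ ∃ λ v → v ∈ L × 2 ≤ deg v L
    Crowded? L with All.all? (λ v → deg v L ≤? 1) L
    ... | yes sparse = inj₁ sparse
    ... | no ¬sparse =
      let v , v∈L , q = find (All.¬All⇒Any¬ (λ v → deg v L ≤? 1) L ¬sparse)
      in inj₂ (v , v∈L , ≰⇒> q)

    ≤3 : ∀ {v} K L → K ++ L ↭ vs → v ∈ K → deg v (K ++ L) ≤ 3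
    ≤3 {v} K L p v∈K =
      ≤-trans (≤-reflexive (deg-↭ v p)) (All.lookup cubic (∈-resp-↭ p (∈-++⁺ˡ v∈K)))

    improve : ∀ K L → K ++ L ↭ vs → Acc _<_ (edges K + edges L) → Bipartition vs
    improve K L p (acc rec) with Crowded? K | Crowded? L
    ... | inj₁ K-sparse | inj₁ L-sparse = K , L , p , K-sparse , L-sparse
    ... | inj₂ (v , v∈K , 2≤) | _ =
      let K′ , q , lt = move K L v∈K 2≤ (≤3 K L p v∈K)
      in improve K′ (v ∷ L) (↭-trans q p) (rec lt)
    ... | inj₁ _ | inj₂ (v , v∈L , 2≤) =
      let p′ = ↭-trans (++-comm L K) p
          L′ , q , lt = move L K v∈L 2≤ (≤3 L K p′ v∈L)
      in improve L′ (v ∷ K) (↭-trans q p′)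
           (rec (subst (edges L′ + edges (v ∷ K) <_) (+-comm (edges L) (edges K)) lt))

  -- Soundness of the search for colourings

  common-row : ∀ v L X → common (row L v) X ≡ deg v (select X L)
  common-row v []      X           = refl
  common-row v (w ∷ L) []          with adj v w
  ... | true  = refl
  ... | false = refl
  common-row v (w ∷ L) (true  ∷ X) with adj v w
  ... | true  = cong suc (common-row v L X)
  ... | false = common-row v L X
  common-row v (w ∷ L) (false ∷ X) with adj v w
  ... | true  = common-row v L X
  ... | false = common-row v L X

  -- The slots divide rs into K, opposite to u, and L, on the side of u; `load` lists all the vertices placed opposite
  -- to u so far, including K.
  data Filled (load : List V) : List Slot → List V → List V → List V → Set where
    []   : Filled load [] [] [] []
    out  : ∀ {s rs K L r} → Filled load s rs K L → Filled load (out ∷ s) (r ∷ rs) K (r ∷ L)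
    full : ∀ {s rs K L r} → deg r load ≤ 1 → Filled load s rs K L →
           Filled load (full ∷ s) (r ∷ rs) (r ∷ K) L
    free : ∀ {s rs K L r} → deg r load ≡ 0 → Filled load s rs K L →
           Filled load (free ∷ s) (r ∷ rs) (r ∷ K) L

  filled-↭ : ∀ {load s rs K L} → Filled load s rs K L → K ++ L ↭ rs
  filled-↭ []                              = refl
  filled-↭ (out {K = K} {L = L} {r = r} F) = ↭-trans (shift r K L) (prep r (filled-↭ F))
  filled-↭ (full _ F)                      = prep _ (filled-↭ F)
  filled-↭ (free _ F)                      = prep _ (filled-↭ F)

  filled-light : ∀ {load s rs K L} → Filled load s rs K L → All (λ a → deg a load ≤ 1) K
  filled-light []         = []
  filled-light (out F)    = filled-light F
  filled-light (full p F) = p ∷ filled-light F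
  filled-light (free p F) = subst (_≤ 1) (sym p) z≤n ∷ filled-light F

  covers-sound : ∀ {load s rs K L} v → Filled load s rs K L → covers s (row rs v) ≡ true → deg v L ≡ 0
  covers-sound v []                 eq = refl
  covers-sound v (out {r = r} F)    eq with adj v r
  covers-sound v (out {r = r} F)    () | true
  covers-sound v (out {r = r} F)    eq | false = covers-sound v F eq
  covers-sound v (full _ F)         eq = covers-sound v F eq
  covers-sound v (free _ F)         eq = covers-sound v F eq

  avoids-sound : ∀ {load s rs K L} v → Filled load s rs K L → avoids s (row rs v) ≡ true →
                 Filled (v ∷ load) s rs K L × deg v K ≡ 0
  avoids-sound v []                 eq = [] , refl
  avoids-sound v (out {r = r} F)    eq =
    let F′ , z = avoids-sound v F eq in out F′ , z
  avoids-sound {load} v (full {r = r} p F) eq with adj v r in e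
  ... | false =
    let F′ , z = avoids-sound v F eq
    in full (subst (_≤ 1) (sym (deg-nonadjacent load (trans (adj-sym r v) e))) p) F′ , z
  avoids-sound {load} v (free {r = r} p F) eq with adj v r in e
  ... | false =
    let F′ , z = avoids-sound v F eq
    in free (trans (deg-nonadjacent load (trans (adj-sym r v) e)) p) F′ , z

  -- Adding `v` to the load raises the degrees of its neighbours only. A `full` neighbour is
  -- refused, and a `free` one goes from 0 to 1; after it `avoids` admits no further neighbour in
  -- `K`.
  fill-sound : ∀ {load s s′ rs K L} v → Filled load s rs K L → fill s (row rs v) ≡ just s′ →
               Filled (v ∷ load) s′ rs K L × deg v K ≤ 1
  fill-sound v [] refl = [] , z≤n
  fill-sound {s = _ ∷ s} {rs = _ ∷ rs} v (out {r = r} F) eq with adj v r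
  fill-sound {s = _ ∷ s} {rs = _ ∷ rs} v (out F) eq | true with fill s (row rs v) in eq′
  fill-sound v (out F) refl | true  | just _ = let F′ , l = fill-sound v F eq′ in out F′ , l
  fill-sound {s = _ ∷ s} {rs = _ ∷ rs} v (out F) eq | false with fill s (row rs v) in eq′
  fill-sound v (out F) refl | false | just _ = let F′ , l = fill-sound v F eq′ in out F′ , l
  fill-sound {s = _ ∷ s} {rs = _ ∷ rs} v (full {r = r} p F) eq with adj v r in e
  fill-sound {s = _ ∷ s} {rs = _ ∷ rs} v (full p F) eq | false with fill s (row rs v) in eq′
  fill-sound {load} v (full {r = r} p F) refl | false | just _ =
    let F′ , l = fill-sound v F eq′
    in full (subst (_≤ 1) (sym (deg-nonadjacent load (trans (adj-sym r v) e))) p) F′ , l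
  fill-sound {s = _ ∷ s} {rs = _ ∷ rs} v (free {r = r} p F) eq with adj v r in e
  fill-sound {s = _ ∷ s} {rs = _ ∷ rs} v (free p F) eq | false with fill s (row rs v) in eq′
  fill-sound {load} v (free {r = r} p F) refl | false | just _ =
    let F′ , l = fill-sound v F eq′
    in free (trans (deg-nonadjacent load (trans (adj-sym r v) e)) p) F′ , l
  fill-sound {s = _ ∷ s} {rs = _ ∷ rs} v (free p F) eq | true with avoids s (row rs v) in eq′
  fill-sound {load} v (free {r = r} p F) refl | true | true =
    let F′ , z = avoids-sound v F eq′
    in full (≤-reflexive (trans (deg-adjacent load (trans (adj-sym r v) e)) (cong suc p))) F′ ,
       ≤-reflexive (cong suc z)

  -- `P` goes opposite to u and `Q` to the side of u. Degrees inside `P` and inside `Q` are not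
  -- tracked, since the lemma is applied to the independent set N.
  search-sound : ∀ y s vs {load rs K L} → T (search y s (map (row rs) vs)) → Filled load s rs K L →
    ∃₂ λ P Q → P ++ Q ↭ vs × All (λ v → deg v K ≤ 1) P × All (λ v → deg v L ≡ 0) Q ×
               length Q ≤ (if y then 1 else 0) × All (λ a → deg a (P ++ load) ≤ 1) K
  search-sound y s [] t F = [] , [] , refl , [] , [] , z≤n , filled-light F
  search-sound y s (v ∷ vs) {load} {rs} t F with fill s (row rs v) in eq
  ... | just s′ with search y s′ (map (row rs) vs) in eq′
  search-sound y s (v ∷ vs) {load} t F | just s′ | true =
    let F′ , l = fill-sound v F eq
        P , Q , p , Ps , Qs , ≤y , Ks = search-sound y s′ vs (Equivalence.from Bool.T-≡ eq′) F′
    in v ∷ P , Q , prep v p , l ∷ Ps , Qs , ≤y ,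
       -- The recursive call counts `v` in the load; the shift counts it with `P` instead.
       All.map (λ {a} → subst (_≤ 1) (deg-↭ a (shift v P load))) Ks
  search-sound true s (v ∷ vs) {rs = rs} t F | just s′ | false
    with c , t′ ← Equivalence.to (Bool.T-∧ {covers s (row rs v)}) t
    with search-sound false s vs t′ F
  -- With `false` the recursive call bounds the length of its second list by 0, so `v` is alone on
  -- the side of u.
  ... | P , [] , p , Ps , Qs , z≤n , Ks =
    P , v ∷ [] , ↭-trans (shift v P []) (prep v p) , Ps ,
    covers-sound v F (Equivalence.to Bool.T-≡ c) ∷ [] , s≤s z≤n , Ks
  search-sound true s (v ∷ vs) {rs = rs} t F | nothing
    with c , t′ ← Equivalence.to (Bool.T-∧ {covers s (row rs v)}) t
    with search-sound false s vs t′ F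
  ... | P , [] , p , Ps , Qs , z≤n , Ks =
    P , v ∷ [] , ↭-trans (shift v P []) (prep v p) , Ps ,
    covers-sound v F (Equivalence.to Bool.T-≡ c) ∷ [] , s≤s z≤n , Ks

  -- For `L` equal to `rs` and `xs` equal to `X`, the load consists initially of the part of R
  -- opposite to u. The bound for the other part is settled here once and for all, because `covers`
  -- keeps later vertices from having neighbours in it.
  slots-sound : ∀ X L xs rs {s} → slots X xs (map (row L) rs) ≡ just s →
    Filled (select X L) s rs (select xs rs) (select (map not xs) rs) ×
    All (λ b → deg b (select (map not X) L) ≤ 1) (select (map not xs) rs)
  slots-sound X L []          []       refl = [] , []
  slots-sound X L (true ∷ xs) (r ∷ rs) eq
    rewrite common-row r L X
    with deg r (select X L) in e | slots X xs (map (row L) rs) in eq′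
  slots-sound X L (true ∷ xs) (r ∷ rs) refl | 0 | just _ =
    let F , ps = slots-sound X L xs rs eq′ in free e F , ps
  slots-sound X L (true ∷ xs) (r ∷ rs) refl | 1 | just _ =
    let F , ps = slots-sound X L xs rs eq′ in full (≤-reflexive e) F , ps
  slots-sound X L (false ∷ xs) (r ∷ rs) eq
    rewrite common-row r L (map not X)
    with deg r (select (map not X) L) in e | slots X xs (map (row L) rs) in eq′
  slots-sound X L (false ∷ xs) (r ∷ rs) refl | 0 | just _ =
    let F , ps = slots-sound X L xs rs eq′ in out F , subst (_≤ 1) (sym e) z≤n ∷ ps
  slots-sound X L (false ∷ xs) (r ∷ rs) refl | 1 | just _ =
    let F , ps = slots-sound X L xs rs eq′ in out F , ≤-reflexive e ∷ ps

  deg-none⁻ : ∀ {v w L} → deg v L ≡ 0 → w ∈ L → adj v w ≡ false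
  deg-none⁻ {v} {L = x ∷ L} z m           with adj v x in vx
  deg-none⁻                 z (here refl) | false = vx
  deg-none⁻                 z (there m)   | false = deg-none⁻ z m

  conjugate-rows : ∀ c L → conjugate c (rows L) ≡ rows (permute c L)
  conjugate-rows c L = begin
    permute c (map (permute c) (map (row L) L))  ≡⟨ cong (permute c) (map-∘ L) ⟨
    permute c (map (permute c ∘ row L) L)        ≡⟨ permute-map (permute c ∘ row L) c L ⟩
    map (permute c ∘ row L) (permute c L)        ≡⟨ map-cong (λ v → permute-map (adj v) c L) _ ⟩
    rows (permute c L)                           ∎
    where open ≡-Reasoning

  deg≤1⇒unique : ∀ {v a b L} → deg v L ≤ 1 → a ∈ L → b ∈ L → adj v a ≡ true → adj v b ≡ true → a ≡ b
  deg≤1⇒unique {v} {L = x ∷ L} l a∈ b∈ va vb with adj v x in vx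
  deg≤1⇒unique l       (here refl) (here refl) va vb | _     = refl
  deg≤1⇒unique l       (here refl) (there b∈)  va vb | true  =
    contradiction (trans (sym vb) (deg-none⁻ (n≤0⇒n≡0 (s≤s⁻¹ l)) b∈)) λ ()
  deg≤1⇒unique l       (there a∈)  (here refl) va vb | true  =
    contradiction (trans (sym va) (deg-none⁻ (n≤0⇒n≡0 (s≤s⁻¹ l)) a∈)) λ ()
  deg≤1⇒unique l       (there a∈)  (there b∈)  va vb | true  =
    contradiction (trans (sym va) (deg-none⁻ (n≤0⇒n≡0 (s≤s⁻¹ l)) a∈)) λ ()
  deg≤1⇒unique l       (here refl) (there b∈)  va vb | false = contradiction (trans (sym vx) va) λ ()
  deg≤1⇒unique l       (there a∈)  (here refl) va vb | false = contradiction (trans (sym vx) vb) λ ()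
  deg≤1⇒unique l       (there a∈)  (there b∈)  va vb | false = deg≤1⇒unique l a∈ b∈ va vb

  -- A vertex of maximum degree, its neighbourhood and the rest

  Edgeless : List V → Set
  Edgeless L = All (λ v → All (λ w → adj v w ≡ false) L) L

  -- By `adjacent` and `nonadjacent` the degree of `u` is `length ns`, so `maximal` says that `u`
  -- has maximum degree.
  record Star (u : V) (ns rs : List V) : Set where
    field
      adjacent    : All (λ v → adj u v ≡ true) ns
      nonadjacent : All (λ v → adj u v ≡ false) rs
      edgeless    : Edgeless ns
      maximal     : All (λ v → deg v (u ∷ ns ++ rs) ≤ length ns) (u ∷ ns ++ rs)

  open Star

  -- Since N is independent, a vertex of `P` has neighbours on its side only in `K`. On the other
  -- side `u` is adjacent only to the at most one vertex of `Q`, and no edge joins `Q` to `L`.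
  bipartition-from-search : ∀ {u ns rs} → Star u ns rs →
    T (colourable (partitions (rows rs)) (map (row rs) ns)) → Bipartition (u ∷ ns ++ rs)
  bipartition-from-search {u} {ns} {rs} star t
    with X , p ← Any.satisfied (Any.map⁻ (Any.any⁻ _ (partitions (rows rs)) t))
    with slots X X (rows rs) in eq
  ... | just s
    with F , Bs ← slots-sound X rs X rs eq
    with P , Q , PQ↭ns , Ps , Qs , |Q|≤1 , As ← search-sound true s ns p F =
    P ++ K , u ∷ Q ++ L , whole , sparse₁ , sparse₂
    where
    K L : List V
    K = select X rs
    L = select (map not X) rs

    P⊆ns : ∀ {v} → v ∈ P → v ∈ ns
    P⊆ns v∈P = ∈-resp-↭ PQ↭ns (∈-++⁺ˡ v∈P)

    Q⊆ns : ∀ {v} → v ∈ Q → v ∈ ns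
    Q⊆ns v∈Q = ∈-resp-↭ PQ↭ns (∈-++⁺ʳ P v∈Q)

    L⊆rs : ∀ {v} → v ∈ L → v ∈ rs
    L⊆rs v∈L = ∈-resp-↭ (filled-↭ F) (∈-++⁺ʳ K v∈L)

    deg-in-ns : ∀ {v M} → v ∈ ns → (∀ {w} → w ∈ M → w ∈ ns) → deg v M ≡ 0
    deg-in-ns v∈ns M⊆ns = deg-none (All.tabulate (λ w∈M →
      All.lookup (All.lookup (edgeless star) v∈ns) (M⊆ns w∈M)))

    whole : (P ++ K) ++ (u ∷ Q ++ L) ↭ u ∷ ns ++ rs
    whole = begin
      (P ++ K) ++ (u ∷ Q ++ L)  ↭⟨ shift u (P ++ K) (Q ++ L) ⟩
      u ∷ (P ++ K) ++ (Q ++ L)  ↭⟨ prep u (++-assoc P K (Q ++ L)) ⟩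
      u ∷ P ++ K ++ Q ++ L      ↭⟨ prep u (++⁺ˡ P (shifts K Q)) ⟩
      u ∷ P ++ Q ++ K ++ L      ↭⟨ prep u (++-assoc P Q (K ++ L)) ⟨
      u ∷ (P ++ Q) ++ (K ++ L)  ↭⟨ prep u (++⁺ PQ↭ns (filled-↭ F)) ⟩
      u ∷ ns ++ rs              ∎
      where open ↭.PermutationReasoning

    sparse₁ : Sparse (P ++ K)
    sparse₁ = All.++⁺
      (All.tabulate (λ {v} v∈P → subst (_≤ 1)
        (sym (trans (deg-++ v P K) (cong (_+ deg v K) (deg-in-ns (P⊆ns v∈P) P⊆ns))))
        (All.lookup Ps v∈P)))
      As

    sparse₂ : Sparse (u ∷ Q ++ L)
    sparse₂ = subst (_≤ 1) (sym deg-u) |Q|≤1 ∷ All.++⁺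
      (All.tabulate (λ {v} v∈Q → ≤-reflexive (trans
        (deg-adjacent (Q ++ L) (trans (adj-sym v u) (All.lookup (adjacent star) (Q⊆ns v∈Q))))
        (cong suc (trans (deg-++ v Q L) (cong₂ _+_ (deg-in-ns (Q⊆ns v∈Q) Q⊆ns) (All.lookup Qs v∈Q)))))))
      (All.tabulate (λ {v} v∈L → subst (_≤ 1) (sym (trans
        (deg-nonadjacent (Q ++ L) (trans (adj-sym v u) (All.lookup (nonadjacent star) (L⊆rs v∈L))))
        (trans (deg-++ v Q L) (cong (_+ deg v L) (deg-none (All.tabulate (λ {q} q∈Q →
          trans (adj-sym v q) (deg-none⁻ (All.lookup Qs q∈Q) v∈L))))))))
        (All.lookup Bs v∈L)))
      where
      deg-u : deg u (u ∷ Q ++ L) ≡ length Q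
      deg-u = begin
        deg u (u ∷ Q ++ L)   ≡⟨ deg-self u (Q ++ L) ⟩
        deg u (Q ++ L)       ≡⟨ deg-++ u Q L ⟩
        deg u Q + deg u L    ≡⟨ cong₂ _+_ (deg-all (All.tabulate (All.lookup (adjacent star) ∘ Q⊆ns)))
                                          (deg-none (All.tabulate (All.lookup (nonadjacent star) ∘ L⊆rs))) ⟩
        length Q + 0         ≡⟨ +-identityʳ (length Q) ⟩
        length Q             ∎
        where open ≡-Reasoning

  bounded-rows : ∀ d L → All (λ v → deg v L ≤ d) L → T (bounded d (rows L))
  bounded-rows d L ps = All.all⁻ _ (All.map⁺ (All.map ≤⇒≤ᵇ ps))

  bounded-rows⁻ : ∀ d L → T (bounded d (rows L)) → All (λ v → deg v L ≤ d) L
  bounded-rows⁻ d L t = All.map (≤ᵇ⇒≤ _ _) (All.map⁻ (All.all⁺ _ (rows L) t))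

  -- N is independent and `u` has no neighbour in R, so N can be set against all other vertices.
  bipartition-sparse-rest : ∀ {u ns rs} → Star u ns rs → T (bounded 1 (rows rs)) → Bipartition (u ∷ ns ++ rs)
  bipartition-sparse-rest {u} {ns} {rs} star t =
    ns , u ∷ rs , shift u ns rs ,
    All.map (λ ps → subst (_≤ 1) (sym (deg-none ps)) z≤n) (edgeless star) ,
    subst (_≤ 1) (sym (trans (deg-self u rs) (deg-none (nonadjacent star)))) z≤n ∷
    All.zipWith (λ {v} (uv , l) → subst (_≤ 1) (sym (deg-nonadjacent rs (trans (adj-sym v u) uv))) l)
                (nonadjacent star , bounded-rows⁻ 1 rs t)

  star-resp-↭ : ∀ {u ns ns′ rs rs′} → ns′ ↭ ns → rs′ ↭ rs → Star u ns rs → Star u ns′ rs′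
  star-resp-↭ {u} {ns} {ns′} {rs} {rs′} p q star = record
    { adjacent    = All-resp-↭ (↭-sym p) (adjacent star)
    ; nonadjacent = All-resp-↭ (↭-sym q) (nonadjacent star)
    ; edgeless    = All-resp-↭ (↭-sym p) (All.map (All-resp-↭ (↭-sym p)) (edgeless star))
    ; maximal     = All-resp-↭ (↭-sym r)
        (All.map (λ {v} → subst₂ _≤_ (deg-↭ v (↭-sym r)) (↭-length (↭-sym p))) (maximal star))
    }
    where
    r : u ∷ ns′ ++ rs′ ↭ u ∷ ns ++ rs
    r = prep u (++⁺ p q)

  columns-rows : ∀ ns rs → columns (length rs) (map (row rs) ns) ≡ map (row ns) rs
  columns-rows ns []       = refl
  columns-rows ns (r ∷ rs) = cong₂ _∷_
    (trans (sym (map-∘ ns)) (map-cong (λ v → adj-sym v r) ns))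
    (trans (cong (columns (length rs)) (sym (map-∘ ns))) (columns-rows ns rs))

  rows-star : ∀ {u ns rs} → Star u ns rs → rows (u ∷ ns ++ rs) ≡ extend (rows rs) (map (row rs) ns)
  rows-star {u} {ns} {rs} star
    rewrite length-map (row rs) ns | length-map (row rs) rs | columns-rows ns rs
          | map-++ (row (u ∷ ns ++ rs)) ns rs
    = cong₂ _∷_
        (cong₂ _∷_ (adj-irrefl u) (trans (map-++ (adj u) ns rs)
          (cong₂ _++_ (map≡replicate (adjacent star)) (map≡replicate (nonadjacent star)))))
        (cong₂ _++_
          (trans (map-cong-local (All.zipWith (λ {v} (uv , ps) →
              cong₂ _∷_ (trans (adj-sym v u) uv)
                (trans (map-++ (adj v) ns rs) (cong (_++ row rs v) (map≡replicate ps))))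
              (adjacent star , edgeless star)))
            (map-∘ ns))
          (trans (map-cong-local (All.map (λ {v} uv →
              cong₂ _∷_ (trans (adj-sym v u) uv) (map-++ (adj v) ns rs))
              (nonadjacent star)))
            (sym (zipWith-diagonal (λ col row → false ∷ col ++ row) (row ns) (row rs) rs))))

  -- Completeness of the enumeration

  module WithoutTriangles
    (no-triangle : ∀ {a b c} → adj a b ≡ true → adj b c ≡ true → adj a c ≡ true → ⊥) where

    -- A common neighbour of `v` and a neighbour `w` of `v` would complete a triangle.
    independent-row : ∀ v L → T (independent? (row L v) (rows L))
    independent-row v L
      rewrite zipWith-diagonal (λ s r → not s ∨ (common (row L v) r ≡ᵇ 0)) (adj v) (row L) L =
      All.all⁻ (λ w → not (adj v w) ∨ (common (row L v) (row L w) ≡ᵇ 0)) {xs = L}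
        (All.tabulate λ {w} _ → check w)
      where
      no-common : ∀ w K → adj v w ≡ true → common (row K v) (row K w) ≡ 0
      no-common w []      vw = refl
      no-common w (x ∷ K) vw with adj v x in vx | adj w x in wx
      ... | true  | true  = contradiction wx (λ wx → no-triangle vw wx vx)
      ... | true  | false = no-common w K vw
      ... | false | _     = no-common w K vw

      check : ∀ w → T (not (adj v w) ∨ (common (row L v) (row L w) ≡ᵇ 0))
      check w with adj v w in vw
      ... | false = _
      ... | true  = ≡⇒≡ᵇ _ 0 (no-common w L vw)

    neighbours-edgeless : ∀ {u L} → All (λ v → adj u v ≡ true) L → Edgeless L
    neighbours-edgeless ps =
      All.map (λ uv → All.map (λ uw → Bool.¬-not (λ vw → no-triangle uv vw uw)) ps) ps

    types-complete : ∀ {u ns rs} → Star u ns rs → All (λ v → row rs v ∈ types (length ns) (rows rs)) ns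
    types-complete {u} {ns} {rs} star = All.tabulate λ {v} v∈ns →
      ∈-filter⁺ (λ S → Bool.T? (independent? S (rows rs) ∧ (weight S <ᵇ length ns)))
        (subst (λ n → row rs v ∈ bitLists n) (trans (length-map (adj v) rs) (sym (length-map (row rs) rs)))
               (bitLists-complete (row rs v)))
        (Equivalence.from Bool.T-∧ (independent-row v rs , <⇒<ᵇ (below v∈ns)))
      where
      below : ∀ {v} → v ∈ ns → deg v rs < length ns
      below {v} v∈ns = begin-strict
        deg v rs                ≤⟨ m≤n+m _ (deg v ns) ⟩
        deg v ns + deg v rs     ≡⟨ deg-++ v ns rs ⟨
        deg v (ns ++ rs)        <⟨ n<1+n _ ⟩
        suc (deg v (ns ++ rs))  ≡⟨ deg-adjacent (ns ++ rs)
                                    (trans (adj-sym v u) (All.lookup (adjacent star) v∈ns)) ⟨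
        deg v (u ∷ ns ++ rs)    ≤⟨ All.lookup (maximal star) (there (∈-++⁺ˡ v∈ns)) ⟩
        length ns               ∎
        where open ≤-Reasoning

    maximum : ∀ (f : V → ℕ) v vs → ∃ λ u → u ∈ v ∷ vs × All (λ w → f w ≤ f u) (v ∷ vs)
    maximum f v vs =
      Extrema.argmax f v vs ,
      [ here , there ]′ (Extrema.argmax-sel f v vs) ,
      Extrema.f[⊥]≤f[argmax] {f = f} v vs ∷ Extrema.f[xs]≤f[argmax] {f = f} v vs

    star-decomposition : ∀ v vs → ∃ λ u → ∃₂ λ ns rs → u ∷ ns ++ rs ↭ v ∷ vs × Star u ns rs
    star-decomposition v vs with u , u∈ , max ← maximum (λ w → deg w (v ∷ vs)) v vs
      with ws , p ← ∈⇒↭∷ u∈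
      with ns , rs , q , ps , qs ← divide (adj u) ws =
      u , ns , rs , r , record
        { adjacent    = ps
        ; nonadjacent = qs
        ; edgeless    = neighbours-edgeless ps
        ; maximal     = All-resp-↭ (↭-sym r)
            (All.map (λ {w} → subst₂ _≤_ (deg-↭ w (↭-sym r)) degree-u) max)
        }
      where
      r : u ∷ ns ++ rs ↭ v ∷ vs
      r = ↭-trans (prep u q) (↭-sym p)

      degree-u : deg u (v ∷ vs) ≡ length ns
      degree-u = begin
        deg u (v ∷ vs)        ≡⟨ deg-↭ u (↭-sym r) ⟩
        deg u (u ∷ ns ++ rs)  ≡⟨ deg-self u (ns ++ rs) ⟩
        deg u (ns ++ rs)      ≡⟨ deg-++ u ns rs ⟩
        deg u ns + deg u rs   ≡⟨ cong₂ _+_ (deg-all ps) (deg-none qs) ⟩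
        length ns + 0         ≡⟨ +-identityʳ _ ⟩
        length ns             ∎
        where open ≡-Reasoning

    extensions-complete : ∀ {u ns} rs → Star u ns rs →
                          ∃ λ vs → vs ↭ u ∷ ns ++ rs × rows vs ∈ extensions (length ns) (rows rs)
    extensions-complete {u} {ns} rs star =
      let ns′ , p , ts∈ = multisets-complete (row rs) (length ns) _ ns refl (types-complete star)
          star′ = star-resp-↭ p refl star
      in u ∷ ns′ ++ rs , prep u (++⁺ʳ rs p) ,
         ∈-filter⁺ (Bool.T? ∘ bounded (length ns))
           (subst (_∈ map (extend (rows rs)) (multisets (length ns) (types (length ns) (rows rs))))
             (sym (rows-star star′)) (∈-map⁺ (extend (rows rs)) ts∈))
           (subst (λ d → T (bounded d (rows (u ∷ ns′ ++ rs)))) (↭-length p)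
             (bounded-rows (length ns′) (u ∷ ns′ ++ rs) (maximal star′)))

    length-rest : ∀ {u v vs} (ns rs : List V) → u ∷ ns ++ rs ↭ v ∷ vs → length rs ≡ length vs ∸ length ns
    length-rest {vs = vs} ns rs p = sym (begin
      length vs ∸ length ns              ≡⟨ cong (_∸ length ns) (suc-injective (↭-length (↭-sym p))) ⟩
      length (ns ++ rs) ∸ length ns      ≡⟨ cong (_∸ length ns) (length-++ ns) ⟩
      length ns + length rs ∸ length ns  ≡⟨ m+n∸m≡n (length ns) (length rs) ⟩
      length rs                          ∎)
      where open ≡-Reasoning

    length-neighbours : ∀ {u v vs} (ns rs : List V) → u ∷ ns ++ rs ↭ v ∷ vs → length ns ≤ length vs
    length-neighbours ns rs p = subst (length ns ≤_)
      (trans (sym (length-++ ns)) (suc-injective (↭-length p))) (m≤m+n _ (length rs))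

    -- The rest R is shorter because `u` is removed, so it can be put into normal form first; then N
    -- is reordered to match a listed multiset. `Star` survives both reorderings.
    normalForms-complete : ∀ fuel vs → length vs ≤ fuel →
                           ∃ λ vs′ → vs′ ↭ vs × rows vs′ ∈ normalForms fuel (length vs)
    normalForms-complete fuel       []       _       = [] , refl , here refl
    normalForms-complete (suc fuel) (v ∷ vs) (s≤s |vs|≤) =
      let u , ns , rs , p , star = star-decomposition v vs
          |rs|≡ = length-rest ns rs p
          rs′ , q , R∈ = normalForms-complete fuel rs
            (≤-trans (≤-reflexive |rs|≡) (≤-trans (m∸n≤m (length vs) (length ns)) |vs|≤))
          vs′ , q′ , M∈ = extensions-complete rs′ (star-resp-↭ refl q star)
      in vs′ , ↭-trans q′ (↭-trans (prep u (++⁺ˡ ns q)) p) ,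
         ∈-concatMap⁺ (λ d → concatMap (extensions d) (normalForms fuel (length vs ∸ d)))
           (lose (∈-upTo⁺ (s≤s (length-neighbours ns rs p)))
             (∈-concatMap⁺ (extensions (length ns))
               (lose (subst (λ n → rows rs′ ∈ normalForms fuel n) |rs|≡ R∈) M∈)))

-- Translation to graphs

does-true : ∀ {P : Set} (P? : Dec P) → does P? ≡ true → P
does-true (yes p) refl = p

lookup-injective : ∀ {xs : List A} → Unique xs → ∀ {i j} → lookup xs i ≡ lookup xs j → i ≡ j
lookup-injective {xs = _ ∷ _}  _            {zero}  {zero}  eq = refl
lookup-injective {xs = x ∷ xs} (x∉xs ∷ _)   {zero}  {suc j} eq = contradiction eq (All.lookup x∉xs (∈-lookup j))
lookup-injective {xs = x ∷ xs} (x∉xs ∷ _)   {suc i} {zero}  eq = contradiction (sym eq) (All.lookup x∉xs (∈-lookup i))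
lookup-injective {xs = _ ∷ _}  (_ ∷ unique) {suc i} {suc j} eq = cong suc (lookup-injective unique eq)

unique-++-disjoint : ∀ xs {ys : List A} {v} → Unique (xs ++ ys) → v ∈ xs → v ∈ ys → ⊥
unique-++-disjoint (x ∷ xs) (x∉ ∷ _) (here refl) v∈ys = All.lookup x∉ (∈-++⁺ʳ xs v∈ys) refl
unique-++-disjoint (x ∷ xs) (_ ∷ u)  (there v∈xs) v∈ys = unique-++-disjoint xs u v∈xs v∈ys

unique-ordering : ∀ {n} {vs : List (Fin n)} → vs ↭ allFin n → Unique vs
unique-ordering {n} p = ↭ₛ.Unique-resp-↭ (setoid (Fin n)) (↭⇒↭ₛ (↭-sym p)) (Unique.allFin⁺ n)

length-filter≤1 : ∀ {P : A → Set} (P? : Decidable P) {xs} → Unique xs → (∀ {x y} → P x → P y → x ≡ y) →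
                  length (filter P? xs) ≤ 1
length-filter≤1 P? {xs} unique all≡
  with filter P? xs | Unique.filter⁺ P? unique | All.all-filter P? xs
... | []        | _             | _           = z≤n
... | _ ∷ []    | _             | _           = s≤s z≤n
... | _ ∷ _ ∷ _ | (x≢y ∷ _) ∷ _ | px ∷ py ∷ _ = contradiction (all≡ px py) x≢y

members : ∀ {n} → List (Fin n) → Subset.Subset n
members L = Vec.tabulate (λ v → does (_∈?_ _≟_ v L))

∈-members⁺ : ∀ {n} {v : Fin n} {L} → v ∈ L → v Subset.∈ members L
∈-members⁺ {v = v} {L} v∈L =
  Vec.lookup⇒[]= v _ (trans (Vec.lookup∘tabulate _ v) (dec-true (_∈?_ _≟_ v L) v∈L))

∈-members⁻ : ∀ {n} {v : Fin n} {L} → v Subset.∈ members L → v ∈ L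
∈-members⁻ {v = v} {L} v∈U =
  does-true (_∈?_ _≟_ v L) (trans (sym (Vec.lookup∘tabulate _ v)) (Vec.[]=⇒lookup v∈U))

length-matrix : ∀ {n} (H : Graph n) → length (matrix H) ≡ n
length-matrix {n} H = trans (length-map (λ v → map (λ w → does (adj? H v w)) (allFin n)) (allFin n))
                            (length-tabulate {n = n} id)

-- With f = id this compares G itself with H, with f = punchIn u it compares G − u with H.
≅-from-ordering : ∀ {k m n} (G : Graph m) (H : Graph n) (f : Fin k → Fin m) ws →
  map (λ v → map (λ w → does (adj? G v w)) ws) ws ≡ matrix H → Unique ws →
  (∀ {i j} → f i ≡ f j → i ≡ j) → (∀ i → f i ∈ ws) → (∀ {v} → v ∈ ws → ∃ λ i → f i ≡ v) →
  pullback f G ≅ H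
≅-from-ordering {k} {m} {n} G H f ws same unique f-inj f∈ws f-onto
  -- Equal matrices have equally many rows, which identifies `n` with the length of `ws`; positions
  -- in `ws` then serve as vertices of `H`.
  with refl ← trans (sym (length-map (λ v → map (λ w → does (adj? G v w)) ws) ws))
                    (trans (cong length same) (length-matrix H))
  = record
  { bijection = permutation to from
      (λ j → lookup-injective unique (trans (lookup-to (from j)) (f-from j)))
      (λ i → f-inj (trans (f-from (to i)) (lookup-to i)))
  ; adjacency = λ i j → mk⇔
      (λ a → does-true (adj? H _ _) (trans (sym (adjacency i j)) (dec-true (adj? G _ _) a)))
      (λ a → does-true (adj? G _ _) (trans (adjacency i j) (dec-true (adj? H _ _) a)))
  }
  where
  to : Fin k → Fin n
  to i = Any.index (f∈ws i)

  lookup-to : ∀ i → lookup ws (to i) ≡ f i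
  lookup-to i = sym (Any.lookup-index (f∈ws i))

  from : Fin n → Fin k
  from j = proj₁ (f-onto (∈-lookup j))

  f-from : ∀ j → f (from j) ≡ lookup ws j
  f-from j = proj₂ (f-onto (∈-lookup j))

  tabulated : tabulate (λ i → tabulate (λ j → does (adj? G (lookup ws i) (lookup ws j)))) ≡
              tabulate (λ i → tabulate (λ j → does (adj? H i j)))
  tabulated = begin
    tabulate (λ i → tabulate (λ j → does (adj? G (lookup ws i) (lookup ws j))))
      ≡⟨ map-tabulate (lookup ws) (λ v → tabulate (λ j → does (adj? G v (lookup ws j)))) ⟨
    map (λ v → tabulate (λ j → does (adj? G v (lookup ws j)))) (tabulate (lookup ws))
      ≡⟨ map-cong (λ v → sym (map-tabulate (lookup ws) (λ w → does (adj? G v w)))) (tabulate (lookup ws)) ⟩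
    map (λ v → map (λ w → does (adj? G v w)) (tabulate (lookup ws))) (tabulate (lookup ws))
      ≡⟨ cong (λ L → map (λ v → map (λ w → does (adj? G v w)) L) L) (tabulate-lookup ws) ⟩
    map (λ v → map (λ w → does (adj? G v w)) ws) ws
      ≡⟨ same ⟩
    matrix H
      ≡⟨ map-tabulate id (λ v → map (λ w → does (adj? H v w)) (allFin n)) ⟩
    tabulate (λ i → map (λ w → does (adj? H i w)) (allFin n))
      ≡⟨ tabulate-cong (λ i → map-tabulate id (λ w → does (adj? H i w))) ⟩
    tabulate (λ i → tabulate (λ j → does (adj? H i j))) ∎
    where open ≡-Reasoning

  adjacency : ∀ i j → does (adj? G (f i) (f j)) ≡ does (adj? H (to i) (to j))
  adjacency i j = trans
    (cong₂ (λ v w → does (adj? G v w)) (sym (lookup-to i)) (sym (lookup-to j)))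
    (tabulate⁻ (≡⇒Pointwise-≡ (tabulate⁻ (≡⇒Pointwise-≡ tabulated) (to i))) (to j))

module Neighbours-of {n} (G : Graph n) (triangle-free : TriangleFree G) where

  adj : Fin n → Fin n → Bool
  adj v w = does (adj? G v w)

  adj-sym : ∀ v w → adj v w ≡ adj w v
  adj-sym v w = does-⇔ (mk⇔ (symmetric G) (symmetric G)) (adj? G v w) (adj? G w v)

  adj-irrefl : ∀ v → adj v v ≡ false
  adj-irrefl v = dec-false (adj? G v v) (loopless G v)

  no-triangle : ∀ {a b c} → adj a b ≡ true → adj b c ≡ true → adj a c ≡ true → ⊥
  no-triangle {a} {b} {c} ab bc ac = triangle-free a b c
    (does-true (adj? G a b) ab , does-true (adj? G b c) bc , symmetric G (does-true (adj? G a c) ac))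

  open Neighbours adj adj-sym adj-irrefl public
  open WithoutTriangles no-triangle public

  -- The two sides count along different lists, `L` and `elements U`. The comparison goes through
  -- uniqueness: any two neighbours of a vertex inside the set coincide.
  sparse⇒independent : ∀ {L} → Sparse L → Independent 1 G (members L)
  sparse⇒independent {L} sparse =
    Extrema.max≤v⁺ z≤n (All.map⁺ {f = degree (induced G U)} (All.tabulate {xs = allFin _} λ {i} _ →
      length-filter≤1 (adj? (induced G U) i) (Unique.allFin⁺ _) (λ {j} {k} ij ik →
        lookup-injective unique (deg≤1⇒unique (All.lookup sparse (member i)) (member j) (member k)
          (dec-true (adj? G _ _) ij) (dec-true (adj? G _ _) ik)))))
    where
    U : Subset.Subset n
    U = members L

    unique : Unique (elements U)
    unique = Unique.filter⁺ _ (Unique.allFin⁺ n)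

    member : ∀ i → lookup (elements U) i ∈ L
    member i = ∈-members⁻ (proj₂ (∈-filter⁻ _ {xs = allFin n} (∈-lookup i)))

  bipartition⇒colourable : Bipartition (allFin n) → Colourable 2 1 G
  bipartition⇒colourable (K , L , p , K-sparse , L-sparse) = U , exactlyOne , independent
    where
    U : Fin 2 → Subset.Subset n
    U 0F = members K
    U 1F = members L

    disjoint : ∀ {v} → v ∈ K → v ∈ L → ⊥
    disjoint = unique-++-disjoint K (unique-ordering p)

    exactlyOne : ∀ v → ∃ λ i → v Subset.∈ U i × (∀ {j} → v Subset.∈ U j → i ≡ j)
    exactlyOne v with ∈-++⁻ K (∈-resp-↭ (↭-sym p) (∈-allFin v))
    ... | inj₁ v∈K = 0F , ∈-members⁺ v∈K , λ
      { {0F} _ → refl ; {1F} v∈ → contradiction (∈-members⁻ v∈) (disjoint v∈K) }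
    ... | inj₂ v∈L = 1F , ∈-members⁺ v∈L , λ
      { {0F} v∈ → contradiction v∈L (disjoint (∈-members⁻ v∈)) ; {1F} _ → refl }

    independent : ∀ i → Independent 1 G (U i)
    independent 0F = sparse⇒independent K-sparse
    independent 1F = sparse⇒independent L-sparse

-- From the evaluated checks to the classification

module _ {n} (cs : List (List ℕ)) (H : Graph (suc n)) (Hs : List (Graph n)) where

  Exceptional : Graph (suc n) → Set₁
  Exceptional G = (G ≅ H) ⊎ ∃ λ u → Any (λ H′ → G - u ≅ H′) Hs

  exceptional-sound : ∀ G vs → vs ↭ allFin (suc n) →
    T (exceptional (matrix H) (map matrix Hs) (map (λ v → map (λ w → does (adj? G v w)) vs) vs)) →
    Exceptional G
  exceptional-sound G []       p t = contradiction (↭-length p) λ ()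
  exceptional-sound G (u ∷ ws) p t with u∉ws ∷ unique ← unique-ordering p =
    [ (λ t → inj₁ (≅-from-ordering G H id (u ∷ ws)
        (does-true (M ≟ᴹ matrix H) (Equivalence.to Bool.T-≡ t)) (u∉ws ∷ unique) id
        (λ v → ∈-resp-↭ (↭-sym p) (∈-allFin v)) (λ {v} _ → v , refl)))
    -- The deleted vertex is the first of the ordering, so the minor is the matrix of `G - u`
    -- relative to `ws`.
    , (λ t → inj₂ (u , Any.map (λ {H′} t → ≅-from-ordering G H′ (punchIn u) ws
          (trans (map-∘ ws) (does-true (minor M ≟ᴹ matrix H′) (Equivalence.to Bool.T-≡ t))) unique
          (punchIn-injective u _ _)
          (λ i → Any.tail (punchInᵢ≢i u i) (∈-resp-↭ (↭-sym p) (∈-allFin (punchIn u i))))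
          (λ v∈ws → let u≢v = All.lookup u∉ws v∈ws in punchOut u≢v , punchIn-punchOut u≢v))
        (Any.map⁻ (Any.any⁻ (λ g → does (minor M ≟ᴹ g)) (map matrix Hs) t))))
    ]′ (Equivalence.to (Bool.T-∨ {does (M ≟ᴹ matrix H)}) t)
    where
    M : Matrix
    M = map (λ v → map (λ w → does (adj? G v w)) (u ∷ ws)) (u ∷ ws)

  module _ (G : Graph (suc n)) (triangle-free : TriangleFree G) (uncolourable : ¬ Colourable 2 1 G) where
    open Neighbours-of G triangle-free

    not-bipartition : ∀ {vs} → vs ↭ allFin (suc n) → ¬ Bipartition vs
    not-bipartition p (K , L , q , sparse) =
      uncolourable (bipartition⇒colourable (K , L , ↭-trans q p , sparse))

    -- The first alternative contradicts uncolourability and the second the maximality of the degree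
    -- of `u`, which leaves the third.
    settled-sound : ∀ {u ns rs} → u ∷ ns ++ rs ↭ allFin (suc n) → Star u ns rs →
      T (settled (length ns) cs (matrix H) (map matrix Hs) (partitions (rows rs)) (map (row rs) ns)
                 (extend (rows rs) (map (row rs) ns))) → Exceptional G
    settled-sound {u} {ns} {rs} p star t =
      [ (λ t → contradiction (bipartition-from-search star t) (not-bipartition p))
      , (λ t → [ (λ t → contradiction bounded-star (subst T (Equivalence.to Bool.T-not-≡ t)))
               , (λ t →
                   let c , e = Any.satisfied
                         (Any.any⁻ (λ c → exceptional (matrix H) (map matrix Hs) (conjugate c M)) cs t)
                   in exceptional-sound G (permute c vs) (↭-trans (permute-↭ c vs) p)
                     (subst (λ M → T (exceptional (matrix H) (map matrix Hs) M))
                       (trans (cong (conjugate c) (sym (rows-star star))) (conjugate-rows c vs)) e))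
               ]′ (Equivalence.to (Bool.T-∨ {not (bounded (length ns) M)}) t))
      ]′ (Equivalence.to (Bool.T-∨ {colourable (partitions (rows rs)) (map (row rs) ns)}) t)
      where
      vs : List (Fin (suc n))
      vs = u ∷ ns ++ rs

      M : Matrix
      M = extend (rows rs) (map (row rs) ns)

      bounded-star : T (bounded (length ns) M)
      bounded-star = subst (λ M → T (bounded (length ns) M)) (rows-star star)
                       (bounded-rows (length ns) vs (Star.maximal star))

    normalForm-sound : ∀ {u ns rs} → u ∷ ns ++ rs ↭ allFin (suc n) → Star u ns rs →
      T (settledNormalForm (length ns) cs (matrix H) (map matrix Hs) (rows rs)) → Exceptional G
    normalForm-sound {u} {ns} {rs} p star t =
      [ (λ t → contradiction (bipartition-sparse-rest star t) (not-bipartition p))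
      , (λ t → let ns′ , q , ts∈ = multisets-complete (row rs) (length ns) _ ns refl (types-complete star) in
          settled-sound (↭-trans (prep u (++⁺ʳ rs q)) p) (star-resp-↭ q refl star)
            (subst (λ d → T (settled d cs (matrix H) (map matrix Hs) (partitions (rows rs)) (map (row rs) ns′)
                                     (extend (rows rs) (map (row rs) ns′))))
              (sym (↭-length q))
              (All.lookup (All.all⁺ _ (multisets (length ns) (types (length ns) (rows rs))) t) ts∈)))
      ]′ (Equivalence.to (Bool.T-∨ {bounded 1 (rows rs)}) t)

    classify : (∀ {d} → 4 ≤ d → d ≤ n → T (verify n cs (matrix H) (map matrix Hs) d)) → Exceptional G
    classify verified =
      let u , ns , rs , p , star = star-decomposition zero (tabulate suc) in
      [ (λ 4≤d →
          let |rs|≡ = trans (length-rest ns rs p) (cong (_∸ length ns) (length-tabulate {n = n} suc))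
              d≤n = subst (length ns ≤_) (length-tabulate {n = n} suc) (length-neighbours ns rs p)
              -- As d ≥ 4, the rest has n ∸ d ≤ n ∸ 4 vertices, so this fuel suffices.
              rs′ , q , R∈ = normalForms-complete (n ∸ 4) rs
                               (subst (_≤ n ∸ 4) (sym |rs|≡) (∸-monoʳ-≤ n 4≤d))
          in normalForm-sound (↭-trans (prep u (++⁺ˡ ns q)) p) (star-resp-↭ refl q star)
               (All.lookup (All.all⁺ _ (normalForms (n ∸ 4) (n ∸ length ns)) (verified 4≤d d≤n))
                 (subst (λ k → rows rs′ ∈ normalForms (n ∸ 4) k) |rs|≡ R∈)))
      , (λ 4≰d → contradiction
          (bipartition-cubic (All.map (λ l → ≤-trans l (s≤s⁻¹ (≰⇒> 4≰d))) (Star.maximal star)))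
          (not-bipartition p))
      ]′ (toSum (4 ≤? length ns))

all-between : ∀ (p : ℕ → Bool) m n → all (λ k → p (m + k)) (upTo n) ≡ true →
              ∀ {d} → m ≤ d → d < m + n → T (p d)
all-between p m n eq {d} m≤d d<m+n =
  subst (T ∘ p) (m+[n∸m]≡n m≤d)
    (All.lookup (All.all⁺ (λ k → p (m + k)) (upTo n) (Equivalence.from Bool.T-≡ eq))
      (∈-upTo⁺ (+-cancelˡ-< m (d ∸ m) n (subst (_< m + n) (sym (m+[n∸m]≡n m≤d)) d<m+n))))

-- A greedy covering found by computer: one of these Lehmer codes brings each uncolourable matrix of maximum degree d
-- to the form required by `exceptional`.
codes : List (List ℕ)
codes =
    (9 ∷ 0 ∷ 0 ∷ 0 ∷ 1 ∷ 0 ∷ 2 ∷ 1 ∷ [])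
  ∷ (8 ∷ 0 ∷ 1 ∷ 0 ∷ 0 ∷ 0 ∷ 2 ∷ 1 ∷ [])
  ∷ (1 ∷ 1 ∷ 0 ∷ 5 ∷ 4 ∷ 3 ∷ 1 ∷ [])
  ∷ (1 ∷ 1 ∷ 7 ∷ 0 ∷ 3 ∷ 3 ∷ 1 ∷ [])
  ∷ (1 ∷ 5 ∷ 6 ∷ 5 ∷ 3 ∷ 3 ∷ 2 ∷ 1 ∷ [])
  ∷ (9 ∷ 0 ∷ 0 ∷ 0 ∷ 1 ∷ 1 ∷ 0 ∷ 2 ∷ 1 ∷ [])
  ∷ (1 ∷ 3 ∷ 0 ∷ 5 ∷ 2 ∷ 4 ∷ 1 ∷ [])
  ∷ (1 ∷ 3 ∷ 7 ∷ 0 ∷ 5 ∷ 2 ∷ 1 ∷ [])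
  ∷ (9 ∷ 5 ∷ 6 ∷ 5 ∷ 4 ∷ 3 ∷ 2 ∷ 1 ∷ [])
  ∷ (6 ∷ 6 ∷ 5 ∷ 5 ∷ 1 ∷ 1 ∷ 2 ∷ 1 ∷ [])
  ∷ (6 ∷ 6 ∷ 5 ∷ 6 ∷ 2 ∷ 1 ∷ 2 ∷ 1 ∷ [])
  ∷ (2 ∷ 2 ∷ 5 ∷ 4 ∷ 0 ∷ 4 ∷ 3 ∷ 2 ∷ 1 ∷ [])
  ∷ (1 ∷ 0 ∷ 0 ∷ 0 ∷ 1 ∷ 0 ∷ 2 ∷ 1 ∷ [])
  ∷ (8 ∷ 5 ∷ 5 ∷ 5 ∷ 4 ∷ 3 ∷ 2 ∷ 1 ∷ [])
  ∷ (2 ∷ 2 ∷ 4 ∷ 4 ∷ 0 ∷ 3 ∷ 3 ∷ 2 ∷ 1 ∷ [])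
  ∷ (3 ∷ 3 ∷ 6 ∷ 0 ∷ 2 ∷ 4 ∷ 1 ∷ [])
  ∷ (3 ∷ 3 ∷ 7 ∷ 0 ∷ 5 ∷ 2 ∷ 1 ∷ [])
  ∷ (1 ∷ 3 ∷ 0 ∷ 5 ∷ 2 ∷ 4 ∷ 1 ∷ 0 ∷ 1 ∷ [])
  ∷ (3 ∷ 8 ∷ 2 ∷ 1 ∷ 4 ∷ 3 ∷ 0 ∷ 2 ∷ [])
  ∷ (1 ∷ 3 ∷ 0 ∷ 6 ∷ 5 ∷ 2 ∷ 1 ∷ 0 ∷ 1 ∷ [])
  ∷ (3 ∷ 7 ∷ 1 ∷ 1 ∷ 4 ∷ 3 ∷ 0 ∷ 2 ∷ [])
  ∷ (3 ∷ 3 ∷ 0 ∷ 5 ∷ 2 ∷ 4 ∷ 1 ∷ 0 ∷ 1 ∷ [])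
  ∷ (3 ∷ 3 ∷ 0 ∷ 6 ∷ 2 ∷ 4 ∷ 1 ∷ 0 ∷ 1 ∷ [])
  ∷ (7 ∷ 6 ∷ 5 ∷ 6 ∷ 2 ∷ 1 ∷ 2 ∷ 1 ∷ [])
  ∷ (1 ∷ 8 ∷ 7 ∷ 6 ∷ 1 ∷ 1 ∷ 1 ∷ 1 ∷ 1 ∷ [])
  ∷ (7 ∷ 7 ∷ 6 ∷ 6 ∷ 3 ∷ 1 ∷ 1 ∷ 2 ∷ 1 ∷ [])
  ∷ (1 ∷ 6 ∷ 6 ∷ 6 ∷ 3 ∷ 4 ∷ 3 ∷ 2 ∷ 1 ∷ [])
  ∷ (8 ∷ 0 ∷ 1 ∷ 0 ∷ 0 ∷ 0 ∷ 1 ∷ 1 ∷ [])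
  ∷ (8 ∷ 5 ∷ 5 ∷ 5 ∷ 3 ∷ 3 ∷ 1 ∷ 1 ∷ [])
  ∷ (6 ∷ 0 ∷ 3 ∷ 2 ∷ 1 ∷ 0 ∷ 2 ∷ [])
  ∷ (1 ∷ 2 ∷ 5 ∷ 4 ∷ 4 ∷ 0 ∷ 3 ∷ 2 ∷ 1 ∷ [])
  ∷ (3 ∷ 2 ∷ 5 ∷ 4 ∷ 4 ∷ 0 ∷ 3 ∷ 2 ∷ 1 ∷ [])
  ∷ (3 ∷ 2 ∷ 4 ∷ 4 ∷ 0 ∷ 4 ∷ 3 ∷ 2 ∷ 1 ∷ [])
  ∷ (6 ∷ 0 ∷ 2 ∷ 2 ∷ 0 ∷ 0 ∷ 3 ∷ [])
  ∷ (1 ∷ 8 ∷ 2 ∷ 1 ∷ 3 ∷ 3 ∷ 0 ∷ 2 ∷ [])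
  ∷ (4 ∷ 3 ∷ 0 ∷ 5 ∷ 4 ∷ 3 ∷ 0 ∷ 0 ∷ 1 ∷ [])
  ∷ (1 ∷ 2 ∷ 4 ∷ 4 ∷ 0 ∷ 4 ∷ 3 ∷ 2 ∷ 1 ∷ [])
  ∷ (1 ∷ 3 ∷ 0 ∷ 6 ∷ 4 ∷ 3 ∷ 0 ∷ 0 ∷ 1 ∷ [])
  ∷ (4 ∷ 3 ∷ 0 ∷ 6 ∷ 3 ∷ 3 ∷ 1 ∷ 0 ∷ 1 ∷ [])
  ∷ (7 ∷ 6 ∷ 6 ∷ 5 ∷ 1 ∷ 1 ∷ 2 ∷ 1 ∷ [])
  ∷ (5 ∷ 0 ∷ 1 ∷ 0 ∷ 1 ∷ 0 ∷ 2 ∷ 1 ∷ 1 ∷ [])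
  ∷ (5 ∷ 0 ∷ 1 ∷ 0 ∷ 1 ∷ 0 ∷ 3 ∷ 1 ∷ 1 ∷ [])
  ∷ (8 ∷ 0 ∷ 4 ∷ 3 ∷ 0 ∷ 0 ∷ 0 ∷ 0 ∷ 1 ∷ [])
  ∷ (6 ∷ 0 ∷ 3 ∷ 2 ∷ 0 ∷ 0 ∷ 0 ∷ 1 ∷ [])
  ∷ (2 ∷ 3 ∷ 7 ∷ 3 ∷ 0 ∷ 4 ∷ 3 ∷ 2 ∷ 1 ∷ [])
  ∷ (5 ∷ 8 ∷ 5 ∷ 5 ∷ 2 ∷ 1 ∷ 1 ∷ 1 ∷ [])
  ∷ (5 ∷ 0 ∷ 2 ∷ 1 ∷ 1 ∷ 0 ∷ 0 ∷ 0 ∷ 1 ∷ [])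
  ∷ (7 ∷ 0 ∷ 3 ∷ 2 ∷ 1 ∷ 0 ∷ 3 ∷ [])
  ∷ (2 ∷ 3 ∷ 6 ∷ 3 ∷ 0 ∷ 4 ∷ 3 ∷ 2 ∷ 1 ∷ [])
  ∷ (5 ∷ 7 ∷ 6 ∷ 5 ∷ 1 ∷ 1 ∷ 2 ∷ 1 ∷ [])
  ∷ (5 ∷ 7 ∷ 5 ∷ 5 ∷ 1 ∷ 3 ∷ 2 ∷ 1 ∷ [])
  ∷ (5 ∷ 8 ∷ 2 ∷ 2 ∷ 4 ∷ 4 ∷ 0 ∷ 2 ∷ 1 ∷ [])
  ∷ (5 ∷ 7 ∷ 6 ∷ 6 ∷ 2 ∷ 2 ∷ 2 ∷ 1 ∷ [])
  ∷ (4 ∷ 8 ∷ 1 ∷ 1 ∷ 4 ∷ 4 ∷ 3 ∷ [])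
  ∷ (0 ∷ 8 ∷ 3 ∷ 3 ∷ 2 ∷ 1 ∷ 0 ∷ 1 ∷ 1 ∷ [])
  ∷ (6 ∷ 0 ∷ 3 ∷ 3 ∷ 0 ∷ 1 ∷ [])
  ∷ (3 ∷ 0 ∷ 0 ∷ 0 ∷ 2 ∷ 1 ∷ 0 ∷ 1 ∷ 1 ∷ []) ∷ []

G₁₋₄ : List (Graph 9)
G₁₋₄ = G₁ ∷ G₂ ∷ G₃ ∷ G₄ ∷ []

-- Opaque, so that the enumeration is evaluated only once.
opaque
  settledAtDegree : ℕ → Bool
  settledAtDegree = verify 9 codes (matrix G₅) (map matrix G₁₋₄)

  settledAtDegree⇒verify : ∀ {d} → T (settledAtDegree d) →
                           T (verify 9 codes (matrix G₅) (map matrix G₁₋₄) d)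
  settledAtDegree⇒verify t = t

  settledAtDegrees4–9 : all (λ k → settledAtDegree (4 + k)) (upTo 6) ≡ true
  settledAtDegrees4–9 = refl

theorem3p1 : (G : Graph 10) → TriangleFree G → IsDefectiveChromaticNumber 1 G 3 →
    (G ≅ G₅) ⊎ (∃[ u* ] ((G - u* ≅ G₁) ⊎ (G - u* ≅ G₂) ⊎ (G - u* ≅ G₃) ⊎ (G - u* ≅ G₄)))
theorem3p1 G triangle-free χ =
  [ inj₁ , (λ (u , m) → inj₂ (u , which m)) ]′
    (classify codes G₅ G₁₋₄ G triangle-free
      -- A colouring with two classes would give 3 ≤ 2.
      (λ col → 1+n≰n (IsDefectiveChromaticNumber.least χ 2 (s≤s z≤n) col))
      -- In order 10 the degrees from 4 on are the six values 4 to 9.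
      (λ 4≤d d≤9 → settledAtDegree⇒verify
        (all-between settledAtDegree 4 6 settledAtDegrees4–9 4≤d (s≤s d≤9))))
  where
  which : ∀ {u} → Any (λ H → G - u ≅ H) G₁₋₄ →
          (G - u ≅ G₁) ⊎ (G - u ≅ G₂) ⊎ (G - u ≅ G₃) ⊎ (G - u ≅ G₄)
  which (here i)                         = inj₁ i
  which (there (here i))                 = inj₂ (inj₁ i)
  which (there (there (here i)))         = inj₂ (inj₂ (inj₁ i))
  which (there (there (there (here i)))) = inj₂ (inj₂ (inj₂ i))
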